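{- There exists a planar graph $G$ with $HG(G)=12$. Specifically, let $m=66^{144}$ and let $G$ be the graph with vertex set $\{u,v\}\cup\{x_i,y_i: 1\le i\le m\}$ whose edges are $uv$, the $m$ edges $x_iy_i$ ($1\le i\le m$), and all edges $ux_i,uy_i,vx_i,vy_i$ ($1\le i\le m$). Then $G$ is planar and $HG(G)=12$.
   Context: The hat guessing game on a finite simple graph $G$ with $q$ colors: each vertex (player) is assigned a hat whose color is an arbitrary element of a fixed set $Q$ of $q$ colors. Each player sees the hat colors of exactly its neighbors in $G$ (not its own). Before the colors are assigned, the players fix a deterministic guessing strategy: for each vertex $w$, a function from the colorings of the neighbors of $w$ to $Q$, which is $w$'s guess for its own color. No communication is allowed. The strategy is winning if for every assignment of colors from $Q$ to all vertices, at least one vertex guesses its own color correctly. The hat guessing number $HG(G)$ is the largest integer $q$ for which a winning strategy with $q$ colors exists. -}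

module Defs where

open import Data.Fin.Base using (Fin; zero; suc)
open import Data.Fin.Properties using (_≟_; +↔⊎)
open import Data.List.Base using (List; []; _∷_; reverse)
open import Data.List.Relation.Unary.Any using (Any)
open import Data.Nat.Base as ℕ using (ℕ; _+_)
open import Data.Product.Base using (Σ-syntax; ∃-syntax; _×_; _,_)
open import Data.Rational.Base as ℚ using (ℚ; 0ℚ; 1ℚ)
open import Data.Refinement.Base using (Refinement-syntax; value)
open import Data.Sum.Base using (_⊎_; inj₁; inj₂; [_,_])
open import Data.Sum.Function.Propositional using (_⊎-↔_)
open import Function.Base using (_∘_)
open import Function.Bundles using (_↔_; mk↔ₛ′)
open import Function.Construct.Composition using (_↔-∘_)
open import Function.Construct.Identity using (↔-id)
open import Function.Definitions using (Injective)
open import Level using (0ℓ)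
open import Relation.Binary.Construct.Closure.Symmetric
  using (SymClosure; fwd; bwd; symmetric)
open import Relation.Binary.Core using (Rel)
open import Relation.Binary.Definitions using (Decidable; Irreflexive; Symmetric)
open import Relation.Binary.PropositionalEquality using (_≡_; _≢_; _≗_; refl)
open import Relation.Nullary.Decidable using (yes; no; map′; _⊎-dec_)
open import Relation.Nullary.Negation using (¬_)

------------------------------------------------------------------------
-- Finite simple graphs

record Graph : Set₁ where
  infix 4 _~_ _~?_
  field
    V      : Set
    size   : ℕ
    finite : Fin size ↔ V
    _~_    : Rel V 0ℓ
    _~?_   : Decidable _~_
    ~-sym  : Symmetric _~_
    ~-irr  : Irreflexive _≡_ _~_

  -- The proof of adjacency is irrelevant, so each neighbour of w occurs
  -- exactly once, even if _~_ is not proposition-valued.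
  Neighbour : V → Set
  Neighbour w = [ x ∈ V ∣ w ~ x ]

------------------------------------------------------------------------
-- The hat guessing game

module _ (G : Graph) where
  open Graph G

  -- A guess is a function of the colouring of the neighbours.  Without
  -- function extensionality, it has to be required separately that it
  -- takes pointwise equal colourings to equal guesses.
  record Strategy (q : ℕ) : Set where
    field
      guess      : ∀ w → (Neighbour w → Fin q) → Fin q
      guess-cong : ∀ w {c d : Neighbour w → Fin q} →
                   c ≗ d → guess w c ≡ guess w d

  Winning : ∀ {q} → Strategy q → Set
  Winning {q} s = (c : V → Fin q) → ∃[ w ] guess w (c ∘ value) ≡ c w
    where open Strategy s

  HasWinningStrategy : ℕ → Set
  HasWinningStrategy q = Σ[ s ∈ Strategy q ] Winning s

  IsHatGuessingNumber : ℕ → Set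
  IsHatGuessingNumber n =
    HasWinningStrategy n × (∀ q → HasWinningStrategy q → q ℕ.≤ n)

------------------------------------------------------------------------
-- Plane drawings whose edges are simple polygonal arcs
--
-- Vertices and bends have rational coordinates.  Two such segments that
-- meet in the real plane meet in a rational point, and in infinitely many
-- if they overlap, so it suffices to speak about rational points.

Point : Set
Point = ℚ × ℚ

Segment : Set
Segment = Point × Point

lerp : ℚ → ℚ → ℚ → ℚ
lerp t a b = (1ℚ ℚ.- t) ℚ.* a ℚ.+ t ℚ.* b

infix 4 _onSegment_

_onSegment_ : Point → Segment → Set
z onSegment ((a₁ , a₂) , (b₁ , b₂)) =
  ∃[ t ] 0ℚ ℚ.≤ t × t ℚ.≤ 1ℚ × z ≡ (lerp t a₁ b₁ , lerp t a₂ b₂)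

-- The polygonal path from p to q through the given bends.
segments : Point → List Point → Point → List Segment
segments p []       q = (p , q) ∷ []
segments p (r ∷ rs) q = (p , r) ∷ segments r rs q

OnPath : Point → Point → List Point → Point → Set
OnPath z p rs q = Any (z onSegment_) (segments p rs q)

-- The path does not meet itself, i.e. it is homeomorphic to an interval.
SimplePath : Point → List Point → Point → Set
SimplePath p []       q = p ≢ q
SimplePath p (r ∷ rs) q =
  p ≢ r ×
  (∀ z → z onSegment (p , r) → OnPath z r rs q → z ≡ r) ×
  SimplePath r rs q

record PlaneDrawing (G : Graph) : Set where
  open Graph G
  field
    pos           : V → Point
    pos-injective : Injective _≡_ _≡_ pos

    -- Only the values at adjacent vertices matter.
    bends         : V → V → List Point
    bends-sym     : ∀ {a b} → a ~ b → bends b a ≡ reverse (bends a b)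

  OnEdge : Point → V → V → Set
  OnEdge z a b = OnPath z (pos a) (bends a b) (pos b)

  field
    simple        : ∀ {a b} → a ~ b → SimplePath (pos a) (bends a b) (pos b)

    -- The interior of an edge contains no vertex and no point of another
    -- edge.
    avoids-vertex : ∀ {a b} → a ~ b → ∀ w → OnEdge (pos w) a b →
                    w ≡ a ⊎ w ≡ b
    avoids-edge   : ∀ {a b c d} → a ~ b → c ~ d →
                    ¬ (a ≡ c × b ≡ d) → ¬ (a ≡ d × b ≡ c) →
                    ∀ z → OnEdge z a b → OnEdge z c d →
                    z ≡ pos a ⊎ z ≡ pos b

Planar : Graph → Set
Planar = PlaneDrawing

------------------------------------------------------------------------
-- The edge uv joined to m disjoint edges xᵢyᵢ

data Vertex (m : ℕ) : Set where
  u v : Vertex m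
  x y : Fin m → Vertex m

data Edge {m : ℕ} : Rel (Vertex m) 0ℓ where
  uv : Edge u v
  xy : ∀ i → Edge (x i) (y i)
  ux : ∀ i → Edge u (x i)
  uy : ∀ i → Edge u (y i)
  vx : ∀ i → Edge v (x i)
  vy : ∀ i → Edge v (y i)

edge? : ∀ {m} → Decidable (Edge {m})
edge? u     u     = no λ ()
edge? u     v     = yes uv
edge? u     (x i) = yes (ux i)
edge? u     (y i) = yes (uy i)
edge? v     u     = no λ ()
edge? v     v     = no λ ()
edge? v     (x i) = yes (vx i)
edge? v     (y i) = yes (vy i)
edge? (x i) u     = no λ ()
edge? (x i) v     = no λ ()
edge? (x i) (x j) = no λ ()
edge? (x i) (y j) = map′ (λ { refl → xy i }) (λ { (xy _) → refl }) (i ≟ j)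
edge? (y i) u     = no λ ()
edge? (y i) v     = no λ ()
edge? (y i) (x j) = no λ ()
edge? (y i) (y j) = no λ ()

Vertex-finite : ∀ m → Fin (2 + (m + m)) ↔ Vertex m
Vertex-finite m =
  mk↔ₛ′ to from to-from from-to ↔-∘ ((↔-id (Fin 2) ⊎-↔ +↔⊎) ↔-∘ +↔⊎)
  where
  to : Fin 2 ⊎ (Fin m ⊎ Fin m) → Vertex m
  to (inj₁ zero)       = u
  to (inj₁ (suc zero)) = v
  to (inj₂ (inj₁ i))   = x i
  to (inj₂ (inj₂ i))   = y i

  from : Vertex m → Fin 2 ⊎ (Fin m ⊎ Fin m)
  from u     = inj₁ zero
  from v     = inj₁ (suc zero)
  from (x i) = inj₂ (inj₁ i)
  from (y i) = inj₂ (inj₂ i)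

  to-from : ∀ w → to (from w) ≡ w
  to-from u     = refl
  to-from v     = refl
  to-from (x i) = refl
  to-from (y i) = refl

  from-to : ∀ w → from (to w) ≡ w
  from-to (inj₁ zero)       = refl
  from-to (inj₁ (suc zero)) = refl
  from-to (inj₂ (inj₁ i))   = refl
  from-to (inj₂ (inj₂ i))   = refl

edgeJoinEdges : ℕ → Graph
edgeJoinEdges m = record
  { V      = Vertex m
  ; size   = 2 + (m + m)
  ; finite = Vertex-finite m
  ; _~_    = SymClosure Edge
  ; _~?_   = λ a b → map′ [ fwd , bwd ] (λ { (fwd e) → inj₁ e ; (bwd e) → inj₂ e })
                          (edge? a b ⊎-dec edge? b a)
  ; ~-sym  = symmetric Edge
  ; ~-irr  = λ { refl (fwd ()) ; refl (bwd ()) }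
  }

module Submission where

-- Drawing: u and v sit at (0 , 1) and (0 , -1), the points x₀ , y₀ , x₁ , y₁ , …
-- follow each other on the positive horizontal axis, and all edges are straight.
-- Two edges are kept apart by an affine function.
--
-- A winning strategy with twelve colours.  For a fixed colouring (a , b) of u and v,
-- a pair x , y can guess right on 24 of its 144 colourings, and six such sets tile all of them.
-- There is a pair xᵢ , yᵢ for every classification of the 144 colourings (a , b)
-- into six classes, with one tile per class.  Hence the pairs (a , b) on which
-- every xᵢ and yᵢ errs cannot number six, since some classification would separate
-- them.  Regarded as edges of a bipartite graph, at most five such pairs (a , b)
-- can be oriented with indegree at most one, and this tells u and v what to guess.
--
-- With more than twelve colours, let u have two colours and v three.  On these
-- six colourings a pair x , y is right for at most 12 q < q² of its colourings,
-- so all the xᵢ and yᵢ can be made to err on all six at once; K₂,₃ has more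
-- edges than vertices, so u and v cannot be right on all of them.

open import Defs
open import Data.Fin.Base as Fin
  using (Fin; zero; suc; toℕ; inject≤; _↑ˡ_; combine; remQuot; splitAt; finToFun; funToFin)
import Data.Fin.Properties as Fin
open import Data.Irrelevant using ([_])
open import Data.List.Base
  using (List; []; _∷_; _++_; length; filter; allFin; cartesianProduct)
open import Data.List.Membership.Propositional using (_∈_)
open import Data.List.Membership.Propositional.Properties
  using (∈-allFin; ∈-cartesianProduct⁺; ∈-filter⁺; ∈-filter⁻)
open import Data.List.Properties using (filter-≐)
open import Data.List.Relation.Binary.Permutation.Propositional
  using (_↭_; ↭-refl; ↭-prep; ↭-sym; ↭-trans)
open import Data.List.Relation.Binary.Permutation.Propositional.Properties
  using (All-resp-↭; ↭-length; ++-comm; ++⁺ʳ; shift; shifts)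
open import Data.List.Relation.Unary.All as All using (All; []; _∷_)
import Data.List.Relation.Unary.All.Properties as All
open import Data.List.Relation.Unary.AllPairs using (_∷_)
open import Data.List.Relation.Unary.Any using (here; there)
open import Data.List.Relation.Unary.Unique.Propositional using (Unique)
import Data.List.Relation.Unary.Unique.Propositional.Properties as Unique
open import Data.Nat.Base as ℕ using (ℕ; zero; suc; _^_; s≤s; z≤n)
open import Data.Nat.DivMod using (_mod_)
import Data.Nat.Properties as ℕ
open import Data.Product.Base
  using (Σ-syntax; ∃-syntax; ∃₂; _×_; _,_; proj₁; proj₂; uncurry)
import Data.Product.Properties as Product
open import Data.Rational.Base
  using (ℚ; 0ℚ; 1ℚ; _+_; _*_; _-_; -_; _≤_; _<_; positive; nonNegative)
open import Data.Rational.Properties hiding (_≟_)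
open import Data.Rational.Solver using (module +-*-Solver)
open import Data.Refinement.Base using (value; _,_)
open import Data.Sign.Base using (Sign) renaming (+ to ⊕; - to ⊖)
open import Data.Sum.Base as Sum using (_⊎_; inj₁; inj₂; swap)
open import Data.Vec.Functional using (updateAt)
open import Data.Vec.Functional.Properties using (updateAt-updates; updateAt-minimal)
open import Function.Base using (_∘_; const; id; case_of_)
open import Function.Definitions using (Injective)
open import Level using (0ℓ)
open import Relation.Binary.Construct.Closure.Symmetric using (fwd; bwd)
open import Relation.Binary.Core using (Rel)
open import Relation.Binary.Definitions using (DecidableEquality; tri<; tri≈; tri>)
open import Relation.Binary.PropositionalEquality hiding ([_])
open import Relation.Nullary.Decidable
  using (Dec; yes; no; recompute; from-yes; decidable-stable; ¬?; _⊎-dec_)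
open import Relation.Nullary.Negation using (¬_; contradiction)

-- The straight-line drawing

lerp-const : ∀ t c → lerp t c c ≡ c
lerp-const = solve 2 (λ t c → (con 1ℚ :- t) :* c :+ t :* c := c) refl
  where open +-*-Solver

lerp-flip : ∀ t a b → lerp (1ℚ - t) b a ≡ lerp t a b
lerp-flip = solve 3 (λ t a b →
  (con 1ℚ :- (con 1ℚ :- t)) :* b :+ (con 1ℚ :- t) :* a :=
  (con 1ℚ :- t) :* a :+ t :* b) refl
  where open +-*-Solver

lerp-zero : ∀ a b → lerp 0ℚ a b ≡ a
lerp-zero = solve 2 (λ a b → (con 1ℚ :- con 0ℚ) :* a :+ con 0ℚ :* b := a) refl
  where open +-*-Solver

lerp-one : ∀ a b → lerp 1ℚ a b ≡ b
lerp-one = solve 2 (λ a b → (con 1ℚ :- con 1ℚ) :* a :+ con 1ℚ :* b := b) refl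
  where open +-*-Solver

p≤q⇒0≤q-p : ∀ {p q} → p ≤ q → 0ℚ ≤ q - p
p≤q⇒0≤q-p {p} {q} p≤q = subst (_≤ q - p) (+-inverseʳ p) (+-monoˡ-≤ (- p) p≤q)

p<q⇒0<q-p : ∀ {p q} → p < q → 0ℚ < q - p
p<q⇒0<q-p {p} {q} p<q = subst (_< q - p) (+-inverseʳ p) (+-monoˡ-< (- p) p<q)

0≤p⇒q-p≤q : ∀ {p} q → 0ℚ ≤ p → q - p ≤ q
0≤p⇒q-p≤q q 0≤p = subst (q - _ ≤_) (+-identityʳ q) (+-monoʳ-≤ q (neg-antimono-≤ 0≤p))

lerp-mono-≤ : ∀ {t a b c d} → 0ℚ ≤ t → t ≤ 1ℚ → a ≤ c → b ≤ d → lerp t a b ≤ lerp t c d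
lerp-mono-≤ {t} 0≤t t≤1 a≤c b≤d = +-mono-≤
  (*-monoˡ-≤-nonNeg (1ℚ - t) {{nonNegative (p≤q⇒0≤q-p t≤1)}} a≤c)
  (*-monoˡ-≤-nonNeg t {{nonNegative 0≤t}} b≤d)

lerp-mono-< : ∀ {t a b c d} → 0ℚ ≤ t → t < 1ℚ → a < c → b ≤ d → lerp t a b < lerp t c d
lerp-mono-< {t} 0≤t t<1 a<c b≤d = +-mono-<-≤
  (*-monoʳ-<-pos (1ℚ - t) {{positive (p<q⇒0<q-p t<1)}} a<c)
  (*-monoˡ-≤-nonNeg t {{nonNegative 0≤t}} b≤d)

onSegment-sym : ∀ {z a b} → z onSegment (a , b) → z onSegment (b , a)
onSegment-sym (t , 0≤t , t≤1 , refl) =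
  1ℚ - t , p≤q⇒0≤q-p t≤1 , 0≤p⇒q-p≤q 1ℚ 0≤t ,
  sym (cong₂ _,_ (lerp-flip t _ _) (lerp-flip t _ _))

onSegment-start : ∀ a b → a onSegment (a , b)
onSegment-start (a₁ , a₂) (b₁ , b₂) =
  0ℚ , ≤-refl , nonNegative⁻¹ 1ℚ , sym (cong₂ _,_ (lerp-zero a₁ b₁) (lerp-zero a₂ b₂))

onSegment-end : ∀ a b → b onSegment (a , b)
onSegment-end a b = onSegment-sym (onSegment-start b a)

-- Separation of segments by affine functions

record Affine : Set where
  infix 9 _⟨_⟩
  field
    _⟨_⟩ : Point → ℚ
    affine : ∀ t a₁ a₂ b₁ b₂ →
      _⟨_⟩ (lerp t a₁ b₁ , lerp t a₂ b₂) ≡ lerp t (_⟨_⟩ (a₁ , a₂)) (_⟨_⟩ (b₁ , b₂))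

open Affine

onSegment-≤ : ∀ F G {a b z} → F ⟨ a ⟩ ≤ G ⟨ a ⟩ → F ⟨ b ⟩ ≤ G ⟨ b ⟩ →
              z onSegment (a , b) → F ⟨ z ⟩ ≤ G ⟨ z ⟩
onSegment-≤ F G a≤ b≤ (t , 0≤t , t≤1 , refl) =
  subst₂ _≤_ (sym (affine F t _ _ _ _)) (sym (affine G t _ _ _ _)) (lerp-mono-≤ 0≤t t≤1 a≤ b≤)

-- For `t < 1` the strict inequality at `a` makes `F` smaller than `G` at `z`, whereas `G ≤ F` holds
-- all along the second segment. So only `t = 1` remains.
separateˡ : ∀ F G {a b c d z} →
            F ⟨ a ⟩ < G ⟨ a ⟩ → F ⟨ b ⟩ ≤ G ⟨ b ⟩ → G ⟨ c ⟩ ≤ F ⟨ c ⟩ → G ⟨ d ⟩ ≤ F ⟨ d ⟩ →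
            z onSegment (a , b) → z onSegment (c , d) → z ≡ b
separateˡ F G {a₁ , a₂} {b₁ , b₂} a< b≤ ≤c ≤d (t , 0≤t , t≤1 , refl) z∈cd with t <? 1ℚ
... | yes t<1 = contradiction (<-≤-trans
  (subst₂ _<_ (sym (affine F t _ _ _ _)) (sym (affine G t _ _ _ _)) (lerp-mono-< 0≤t t<1 a< b≤))
  (onSegment-≤ G F ≤c ≤d z∈cd)) (<-irrefl refl)
... | no  t≮1 with refl ← ≤-antisym t≤1 (≮⇒≥ t≮1) = cong₂ _,_ (lerp-one a₁ b₁) (lerp-one a₂ b₂)

separateʳ : ∀ F G {a b c d z} →
            F ⟨ a ⟩ ≤ G ⟨ a ⟩ → F ⟨ b ⟩ < G ⟨ b ⟩ → G ⟨ c ⟩ ≤ F ⟨ c ⟩ → G ⟨ d ⟩ ≤ F ⟨ d ⟩ →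
            z onSegment (a , b) → z onSegment (c , d) → z ≡ a
separateʳ F G a≤ b< ≤c ≤d z∈ab = separateˡ F G b< a≤ ≤c ≤d (onSegment-sym z∈ab)

-- Coordinates of the drawing

height : Sign → ℚ
height ⊕ = 1ℚ
height ⊖ = - 1ℚ

-- Starting at 1 keeps the base points off the vertical line through the apexes, which carries the
-- edge between `u` and `v`.
abscissa : ℕ → ℚ
abscissa zero    = 1ℚ
abscissa (suc n) = 1ℚ + abscissa n

horizontal : Affine
horizontal = record { _⟨_⟩ = proj₁ ; affine = λ _ _ _ _ _ → refl }

constant : ℚ → Affine
constant r = record { _⟨_⟩ = λ _ → r ; affine = λ t _ _ _ _ → sym (lerp-const t r) }

-- Vanishes on the horizontal axis and is positive exactly in the half-plane of the apex `s`.
side : Sign → Affine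
side s = record
  { _⟨_⟩   = λ p → height s * proj₂ p
  ; affine = λ t _ a _ b → solve 4 (λ h t a b →
      h :* ((con 1ℚ :- t) :* a :+ t :* b) := (con 1ℚ :- t) :* (h :* a) :+ t :* (h :* b))
      refl (height s) t a b
  }
  where open +-*-Solver

-- Equality of horizontal and cone s r defines the line through (0, height s) and (r, 0).
cone : Sign → ℚ → Affine
cone s r = record
  { _⟨_⟩   = λ p → r * (1ℚ - height s * proj₂ p)
  ; affine = λ t _ a _ b → solve 5 (λ r h t a b →
      r :* (con 1ℚ :- h :* ((con 1ℚ :- t) :* a :+ t :* b)) :=
      (con 1ℚ :- t) :* (r :* (con 1ℚ :- h :* a)) :+ t :* (r :* (con 1ℚ :- h :* b)))
      refl r (height s) t a b
  }
  where open +-*-Solver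

data Site : Set where
  apex : Sign → Site
  base : ℕ → Site

place : Site → Point
place (apex s) = 0ℚ , height s
place (base n) = abscissa n , 0ℚ

side-base : ∀ s n → side s ⟨ place (base n) ⟩ ≡ 0ℚ
side-base s n = *-zeroʳ (height s)

cone-apex : ∀ s r → cone s r ⟨ place (apex s) ⟩ ≡ 0ℚ
cone-apex ⊕ r = *-zeroʳ r
cone-apex ⊖ r = *-zeroʳ r

cone-base : ∀ s r n → cone s r ⟨ place (base n) ⟩ ≡ r
cone-base s r n = trans (cong (λ p → r * (1ℚ - p)) (*-zeroʳ (height s))) (*-identityʳ r)

abscissa-suc : ∀ n → abscissa n < abscissa (suc n)
abscissa-suc n =
  subst (_< 1ℚ + abscissa n) (+-identityˡ _) (+-monoˡ-< (abscissa n) (positive⁻¹ 1ℚ))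

abscissa-mono-≤ : ∀ {m n} → m ℕ.≤ n → abscissa m ≤ abscissa n
abscissa-mono-≤ m≤n = go (ℕ.≤⇒≤′ m≤n)
  where
  go : ∀ {m n} → m ℕ.≤′ n → abscissa m ≤ abscissa n
  go (ℕ.≤′-reflexive refl) = ≤-refl
  go (ℕ.≤′-step {n} m≤n)   = ≤-trans (go m≤n) (<⇒≤ (abscissa-suc n))

abscissa-mono-< : ∀ {m n} → m ℕ.< n → abscissa m < abscissa n
abscissa-mono-< {m} m<n = <-≤-trans (abscissa-suc m) (abscissa-mono-≤ m<n)

1≤abscissa : ∀ n → 1ℚ ≤ abscissa n
1≤abscissa n = abscissa-mono-≤ (ℕ.z≤n {n})

0<abscissa : ∀ n → 0ℚ < abscissa n
0<abscissa n = <-≤-trans (positive⁻¹ 1ℚ) (1≤abscissa n)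

abscissa-injective : Injective _≡_ _≡_ abscissa
abscissa-injective {m} {n} eq with ℕ.<-cmp m n
... | tri< m<n _ _ = contradiction (abscissa-mono-< m<n) (<-irrefl eq)
... | tri≈ _ m≡n _ = m≡n
... | tri> _ _ n<m = contradiction (abscissa-mono-< n<m) (<-irrefl (sym eq))

place-injective : Injective _≡_ _≡_ place
place-injective {apex ⊕} {apex ⊕} _  = refl
place-injective {apex ⊕} {apex ⊖} ()
place-injective {apex ⊖} {apex ⊕} ()
place-injective {apex ⊖} {apex ⊖} _  = refl
place-injective {apex s} {base n} eq =
  contradiction (0<abscissa n) (<-irrefl (cong proj₁ eq))
place-injective {base n} {apex s} eq =
  contradiction (0<abscissa n) (<-irrefl (sym (cong proj₁ eq)))
place-injective {base n} {base k} eq = cong base (abscissa-injective (cong proj₁ eq))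

-- Rungs join all consecutive base points, also each `y i` to the next `x`. This larger graph is
-- drawn just as well, and no parity condition arises.
data Link : Rel Site 0ℓ where
  axis  : Link (apex ⊕) (apex ⊖)
  spoke : ∀ s n → Link (apex s) (base n)
  rung  : ∀ n → Link (base n) (base (suc n))

_∈[_,_] : Point → Site → Site → Set
z ∈[ a , b ] = z onSegment (place a , place b)

Ends : Point → Site → Site → Set
Ends z a b = z ≡ place a ⊎ z ≡ place b

-- The second spoke lies on the line through the apex and `base k`. For `n` different from `k`,
-- `base n` is strictly to one side of that line, so the first spoke meets it only at the apex.
sameApex : ∀ s n k z → z ∈[ apex s , base n ] → z ∈[ apex s , base k ] →
           (apex s ≡ apex s × base n ≡ base k) ⊎ Ends z (apex s) (base n)
sameApex s n k _ p q with ℕ.<-cmp n k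
... | tri< n<k _ _ = inj₂ (inj₁ (separateʳ horizontal (cone s (abscissa k))
  (≤-reflexive (sym (cone-apex s (abscissa k))))
  (<-≤-trans (abscissa-mono-< n<k) (≤-reflexive (sym (cone-base s (abscissa k) n))))
  (≤-reflexive (cone-apex s (abscissa k))) (≤-reflexive (cone-base s (abscissa k) k)) p q))
... | tri≈ _ refl _ = inj₁ (refl , refl)
... | tri> _ _ k<n = inj₂ (inj₁ (separateʳ (cone s (abscissa k)) horizontal
  (≤-reflexive (cone-apex s (abscissa k)))
  (≤-<-trans (≤-reflexive (cone-base s (abscissa k) n)) (abscissa-mono-< k<n))
  (≤-reflexive (sym (cone-apex s (abscissa k))))
  (≤-reflexive (sym (cone-base s (abscissa k) k))) p q))

-- Only ends of the first link may be meeting points, so every ordered pair of kinds is a case.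
-- Disjoint links also land in `Ends`, vacuously, since separation asks for strictness at one end
-- only.
crossing : ∀ {a b c d} → Link a b → Link c d → ∀ z → z ∈[ a , b ] → z ∈[ c , d ] →
           (a ≡ c × b ≡ d) ⊎ Ends z a b
crossing axis axis _ _ _ = inj₁ (refl , refl)
-- The line from the upper apex to `(1 , 0)`: the axis touches it only at that apex, and every base
-- point is on it or to its right.
crossing axis (spoke ⊕ n) _ p q = inj₂ (inj₁ (separateʳ horizontal (cone ⊕ 1ℚ)
  ≤-refl (positive⁻¹ _) ≤-refl (1≤abscissa n) p q))
crossing axis (spoke ⊖ n) _ p q = inj₂ (inj₂ (separateˡ horizontal (cone ⊖ 1ℚ)
  (positive⁻¹ _) ≤-refl ≤-refl (1≤abscissa n) p q))
crossing axis (rung n) _ p q = inj₂ (inj₁ (separateʳ horizontal (constant 1ℚ)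
  (nonNegative⁻¹ 1ℚ) (positive⁻¹ 1ℚ) (1≤abscissa n) (1≤abscissa (suc n)) p q))
crossing (spoke s n) axis _ p q = inj₂ (inj₁ (separateʳ (constant 0ℚ) horizontal
  ≤-refl (0<abscissa n) ≤-refl ≤-refl p q))
crossing (spoke ⊕ n) (spoke ⊖ k) _ p q = inj₂ (inj₂ (separateˡ (constant 0ℚ) (side ⊕)
  (positive⁻¹ 1ℚ) ≤-refl (nonPositive⁻¹ (- 1ℚ)) ≤-refl p q))
crossing (spoke ⊖ n) (spoke ⊕ k) _ p q = inj₂ (inj₂ (separateˡ (constant 0ℚ) (side ⊖)
  (positive⁻¹ 1ℚ) ≤-refl (nonPositive⁻¹ (- 1ℚ)) ≤-refl p q))
crossing (spoke ⊕ n) (rung k) _ p q = inj₂ (inj₂ (separateˡ (constant 0ℚ) (side ⊕)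
  (positive⁻¹ 1ℚ) ≤-refl ≤-refl ≤-refl p q))
crossing (spoke ⊖ n) (rung k) _ p q = inj₂ (inj₂ (separateˡ (constant 0ℚ) (side ⊖)
  (positive⁻¹ 1ℚ) ≤-refl ≤-refl ≤-refl p q))
crossing (spoke ⊕ n) (spoke ⊕ k) = sameApex ⊕ n k
crossing (spoke ⊖ n) (spoke ⊖ k) = sameApex ⊖ n k
crossing (rung n) axis _ p q = inj₂ (inj₁ (separateʳ (constant 0ℚ) horizontal
  (<⇒≤ (0<abscissa n)) (0<abscissa (suc n)) ≤-refl ≤-refl p q))
crossing (rung n) (spoke s k) _ p q with k ℕ.≤? n
-- A rung starting at or right of `base k` is cut off by the vertical line through `base k`; one
-- ending at or left of it, by the line of the spoke itself.
... | yes k≤n = inj₂ (inj₁ (separateʳ (constant (abscissa k)) horizontal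
  (abscissa-mono-≤ k≤n) (abscissa-mono-< (ℕ.s≤s k≤n)) (<⇒≤ (0<abscissa k)) ≤-refl p q))
... | no  k≰n = inj₂ (inj₂ (separateˡ horizontal (cone s (abscissa k))
  (<-≤-trans (abscissa-mono-< (ℕ.≰⇒> k≰n)) (≤-reflexive (sym (cone-base s (abscissa k) n))))
  (≤-trans (abscissa-mono-≤ (ℕ.≰⇒> k≰n)) (≤-reflexive (sym (cone-base s (abscissa k) (suc n)))))
  (≤-reflexive (cone-apex s (abscissa k))) (≤-reflexive (cone-base s (abscissa k) k)) p q))
crossing (rung n) (rung k) _ p q with ℕ.<-cmp n k
... | tri< n<k _ _ = inj₂ (inj₂ (separateˡ horizontal (constant (abscissa k))
  (abscissa-mono-< n<k) (abscissa-mono-≤ n<k) ≤-refl (<⇒≤ (abscissa-suc k)) p q))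
... | tri≈ _ refl _ = inj₁ (refl , refl)
... | tri> _ _ k<n = inj₂ (inj₁ (separateʳ (constant (abscissa n)) horizontal
  ≤-refl (abscissa-suc n) (<⇒≤ (abscissa-mono-< k<n)) (abscissa-mono-≤ k<n) p q))

-- Placing the vertices of the graph

site : ∀ {m} → Vertex m → Site
site u     = apex ⊕
site v     = apex ⊖
site (x i) = base (toℕ i ℕ.+ toℕ i)
site (y i) = base (suc (toℕ i ℕ.+ toℕ i))

double-injective : ∀ {m n} → m ℕ.+ m ≡ n ℕ.+ n → m ≡ n
double-injective {zero}  {zero}  _  = refl
double-injective {suc m} {suc n} eq rewrite ℕ.+-suc m m | ℕ.+-suc n n =
  cong suc (double-injective (ℕ.suc-injective (ℕ.suc-injective eq)))

double≢suc-double : ∀ m n → m ℕ.+ m ≢ suc (n ℕ.+ n)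
double≢suc-double (suc m) zero    eq rewrite ℕ.+-suc m m = case eq of λ ()
double≢suc-double (suc m) (suc n) eq rewrite ℕ.+-suc m m | ℕ.+-suc n n =
  double≢suc-double m n (ℕ.suc-injective (ℕ.suc-injective eq))

base-injective : ∀ {m n} → base m ≡ base n → m ≡ n
base-injective refl = refl

site-injective : ∀ {m} → Injective _≡_ _≡_ (site {m})
site-injective {_} {u}   {u}   _  = refl
site-injective {_} {v}   {v}   _  = refl
site-injective {_} {x i} {x j} eq =
  cong x (Fin.toℕ-injective (double-injective (base-injective eq)))
site-injective {_} {y i} {y j} eq =
  cong y (Fin.toℕ-injective (double-injective (ℕ.suc-injective (base-injective eq))))
site-injective {_} {x i} {y j} eq =
  contradiction (base-injective eq) (double≢suc-double (toℕ i) (toℕ j))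
site-injective {_} {y i} {x j} eq =
  contradiction (sym (base-injective eq)) (double≢suc-double (toℕ j) (toℕ i))

link : ∀ {m} {a b : Vertex m} → Edge a b → Link (site a) (site b)
link uv     = axis
link (xy i) = rung _
link (ux i) = spoke ⊕ _
link (uy i) = spoke ⊕ _
link (vx i) = spoke ⊖ _
link (vy i) = spoke ⊖ _

module _ (m : ℕ) where
  private
    G = edgeJoinEdges m

    locate : Vertex m → Point
    locate w = place (site w)

  open Graph G using (_~_; ~-irr)

  locate-injective : Injective _≡_ _≡_ locate
  locate-injective eq = site-injective (place-injective eq)

  arc : ∀ {z} {a b : Point} → OnPath z a [] b → z onSegment (a , b)
  arc (here p) = p

  avoids : ∀ {a b c d} → a ~ b → c ~ d → ∀ z →
           z onSegment (locate a , locate b) → z onSegment (locate c , locate d) →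
           (a ≡ c × b ≡ d) ⊎ (a ≡ d × b ≡ c) ⊎ Ends z (site a) (site b)
  avoids (fwd e) (fwd f) z p q with crossing (link e) (link f) z p q
  ... | inj₁ (s , t) = inj₁ (site-injective s , site-injective t)
  ... | inj₂ end     = inj₂ (inj₂ end)
  avoids (fwd e) (bwd f) z p q with crossing (link e) (link f) z p (onSegment-sym q)
  ... | inj₁ (s , t) = inj₂ (inj₁ (site-injective s , site-injective t))
  ... | inj₂ end     = inj₂ (inj₂ end)
  avoids (bwd e) (fwd f) z p q with crossing (link e) (link f) z (onSegment-sym p) q
  ... | inj₁ (s , t) = inj₂ (inj₁ (site-injective t , site-injective s))
  ... | inj₂ end     = inj₂ (inj₂ (swap end))
  avoids (bwd e) (bwd f) z p q with crossing (link e) (link f) z (onSegment-sym p) (onSegment-sym q)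
  ... | inj₁ (s , t) = inj₁ (site-injective t , site-injective s)
  ... | inj₂ end     = inj₂ (inj₂ (swap end))

  incident : ∀ w → ∃[ w′ ] w ~ w′
  incident u     = v , fwd uv
  incident v     = u , bwd uv
  incident (x i) = u , bwd (ux i)
  incident (y i) = u , bwd (uy i)

  -- Every vertex is an end of some edge, so a vertex on an edge is a crossing.
  avoids-vertices : ∀ {a b} → a ~ b → ∀ w → locate w onSegment (locate a , locate b) →
                    w ≡ a ⊎ w ≡ b
  avoids-vertices {a} {b} a~b w p with incident w
  ... | w′ , w~w′ =
    conclude (avoids a~b w~w′ (locate w) p (onSegment-start (locate w) (locate w′)))
    where
    conclude : (a ≡ w × b ≡ w′) ⊎ (a ≡ w′ × b ≡ w) ⊎ Ends (locate w) (site a) (site b) →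
               w ≡ a ⊎ w ≡ b
    conclude (inj₁ (a≡w , _))        = inj₁ (sym a≡w)
    conclude (inj₂ (inj₁ (_ , b≡w))) = inj₂ (sym b≡w)
    conclude (inj₂ (inj₂ (inj₁ eq))) = inj₁ (locate-injective eq)
    conclude (inj₂ (inj₂ (inj₂ eq))) = inj₂ (locate-injective eq)

  avoids-edges : ∀ {a b c d} → a ~ b → c ~ d →
    ¬ (a ≡ c × b ≡ d) → ¬ (a ≡ d × b ≡ c) → ∀ z →
    OnPath z (locate a) [] (locate b) → OnPath z (locate c) [] (locate d) →
    z ≡ locate a ⊎ z ≡ locate b
  avoids-edges a~b c~d ≢₁ ≢₂ z p q with avoids a~b c~d z (arc p) (arc q)
  ... | inj₁ eqs        = contradiction eqs ≢₁
  ... | inj₂ (inj₁ eqs) = contradiction eqs ≢₂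
  ... | inj₂ (inj₂ end) = end

  planar : Planar G
  planar = record
    { pos           = locate
    ; pos-injective = locate-injective
    ; bends         = λ _ _ → []
    ; bends-sym     = λ _ → refl
    ; simple        = λ a~b eq → ~-irr (locate-injective eq) a~b
    ; avoids-vertex = λ a~b w p → avoids-vertices a~b w (arc p)
    ; avoids-edge   = avoids-edges
    }

-- 12 colours

module _ {q : ℕ} where
  Colours : Set
  Colours = Fin q × Fin q

  Guesses : (f g : Fin q → Fin q) → Colours → Set
  Guesses f g (a , b) = f b ≡ a ⊎ g a ≡ b

  -- The pairs are edges between colours of `u` and colours of `v`. Through `f` each colour of `v`
  -- claims one edge, through `g` each colour of `u`; every listed edge must be claimed.
  Guessable : List Colours → Set
  Guessable L = ∃₂ λ f g → All (Guesses f g) L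

  resp-↭ : ∀ {L M} → L ↭ M → Guessable M → Guessable L
  resp-↭ π (f , g , ok) = f , g , All-resp-↭ (↭-sym π) ok

  Row Off : Fin q → List Colours → Set
  Row a = All λ p → proj₁ p ≡ a
  Off a = All λ p → proj₁ p ≢ a

  -- No pair of `L` lies in row `a`, so `g` can be changed at `a` without loss elsewhere.
  fresh : ∀ {a b L} → Off a L → Guessable L → Guessable ((a , b) ∷ L)
  fresh {a} {b} off (f , g , ok) = f , updateAt g a (const b) ,
    inj₂ (updateAt-updates a g) ∷
    All.zipWith (λ {p} (p≢a , okₚ) →
      Sum.map₂ (trans (updateAt-minimal (proj₁ p) a g p≢a)) okₚ) (off , ok)

  oneRow : ∀ {a L} → Row a L → Guessable L
  oneRow {a} row = const a , id , All.map (inj₁ ∘ sym) row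

  -- Column b₂ is spent on the row a′, and the row a compensates for it.
  twoRows : ∀ {a a′ b₁ b₂ L} → a ≢ a′ → Row a L →
            Guessable ((a′ , b₁) ∷ (a′ , b₂) ∷ L)
  twoRows {a} {a′} {b₁} {b₂} {L} a≢a′ row =
    f , g , inj₂ (updateAt-updates a′ (const b₂)) ∷ inj₁ f-b₂ ∷ All.map guessed row
    where
    f g : Fin q → Fin q
    f = updateAt (const a) b₂ (const a′)
    g = updateAt (const b₂) a′ (const b₁)

    f-b₂ : f b₂ ≡ a′
    f-b₂ = updateAt-updates b₂ (const a)

    guessed : ∀ {p} → proj₁ p ≡ a → Guesses f g p
    guessed {_ , b} refl with b Fin.≟ b₂
    ... | yes refl = inj₂ (updateAt-minimal a a′ (const b₂) a≢a′)
    ... | no  b≢b₂ = inj₁ (updateAt-minimal b b₂ (const a) b≢b₂)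

  split : ∀ a L → ∃₂ λ A R → L ↭ A ++ R × Row a A × Off a R
  split a [] = [] , [] , ↭-refl , [] , []
  split a (p ∷ L) with proj₁ p Fin.≟ a | split a L
  ... | yes p≡a | A , R , π , row , off = p ∷ A , R , ↭-prep p π , p≡a ∷ row , off
  ... | no  p≢a | A , R , π , row , off =
    A , p ∷ R , ↭-trans (↭-prep p π) (↭-sym (shift p A R)) , row , p≢a ∷ off

  tooLong : ∀ {A : Set} {n k} → n ℕ.≤ 5 → 6 ℕ.+ k ℕ.≤ n → A
  tooLong n≤5 len = contradiction (ℕ.≤-trans (ℕ.m≤m+n 6 _) (ℕ.≤-trans len n≤5)) (ℕ.<-irrefl refl)

  -- A row with a single pair is removed by `fresh`. If all rows have at least two pairs, five pairs
  -- fill at most two rows, and of two rows one has exactly two pairs, as `twoRows` asks.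
  atMostFive : ∀ n → n ℕ.≤ 5 → ∀ L → length L ℕ.≤ n → Guessable L

  twoEdges : ∀ n → suc n ℕ.≤ 5 → ∀ {a a′ b b₁ b′} A A′ R → a ≢ a′ →
             Row a A → Row a′ A′ → Off a R → Off a′ R →
             let L = (a , b) ∷ (a , b₁) ∷ (a′ , b′) ∷ (A′ ++ R) ++ A
             in length L ℕ.≤ suc n → Guessable L
  twoEdges n n<5 {a} {a′} {b} {b₁} {b′} A [] R a≢a′ row _ _ off′ (s≤s len) = resp-↭
    (shift (a′ , b′) ((a , b) ∷ (a , b₁) ∷ []) (R ++ A))
    (fresh (a≢a′ ∷ a≢a′ ∷ All.++⁺ off′ (All.map (λ { refl → a≢a′ }) row))
      (atMostFive n (ℕ.<⇒≤ n<5) _ len))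
  twoEdges n n<5 {a} {a′} {b} {b₁} {b′} A ((_ , b₂) ∷ []) [] a≢a′ row (refl ∷ _) _ _ _ =
    resp-↭
    (shifts ((a , b) ∷ (a , b₁) ∷ []) ((a′ , b′) ∷ (a′ , b₂) ∷ []))
    (twoRows a≢a′ (refl ∷ refl ∷ row))
  twoEdges n n<5 {a} {a′} {b} {b₁} {b′} A ((_ , b₂) ∷ []) (c ∷ [])
           a≢a′ row (refl ∷ _) (c≢a ∷ _) (c≢a′ ∷ _) _ = resp-↭
    (↭-trans (shift c ((a , b) ∷ (a , b₁) ∷ (a′ , b′) ∷ (a′ , b₂) ∷ []) A)
      (↭-prep c (shifts ((a , b) ∷ (a , b₁) ∷ []) ((a′ , b′) ∷ (a′ , b₂) ∷ []))))
    (fresh (≢-sym c≢a′ ∷ ≢-sym c≢a′ ∷ ≢-sym c≢a ∷ ≢-sym c≢a ∷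
           All.map (λ { refl → ≢-sym c≢a }) row)
      (twoRows a≢a′ (refl ∷ refl ∷ row)))
  -- Here row `a` is the one with just two pairs, so the rows exchange roles.
  twoEdges n n<5 [] (_ ∷ _ ∷ []) [] a≢a′ _ row′ _ _ _ =
    twoRows (≢-sym a≢a′) (refl ∷ row′)
  twoEdges n n<5 _ (_ ∷ []) (_ ∷ _ ∷ _) _ _ _ _ _ len = tooLong n<5 len
  twoEdges n n<5 (_ ∷ _) (_ ∷ _ ∷ []) [] _ _ _ _ _ len = tooLong n<5 len
  twoEdges n n<5 _ (_ ∷ _ ∷ []) (_ ∷ _) _ _ _ _ _ len = tooLong n<5 len
  twoEdges n n<5 _ (_ ∷ _ ∷ _ ∷ _) _ _ _ _ _ _ len = tooLong n<5 len

  atMostFive n n≤5 [] len = id , id , []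
  atMostFive (suc n) n≤5 ((a , b) ∷ L) (s≤s len) with split a L
  ... | [] , R , π , _ , off =
    resp-↭ (↭-prep _ π)
      (fresh off (atMostFive n (ℕ.<⇒≤ n≤5) R (subst (ℕ._≤ n) (↭-length π) len)))
  ... | (_ , b₁) ∷ A , [] , π , row , _ = resp-↭ (↭-prep _ π) (oneRow (refl ∷ All.++⁺ row []))
  ... | (_ , b₁) ∷ A , (a′ , b′) ∷ R , π , refl ∷ row , a′≢a ∷ off with split a′ R
  ...   | A′ , R′ , ρ , row′ , off′ = resp-↭ σ
    (twoEdges n n≤5 A A′ R′ (≢-sym a′≢a) row row′ (All.++⁻ʳ A′ (All-resp-↭ ρ off)) off′
      (subst (ℕ._≤ suc n) (↭-length σ) (s≤s len)))
    where
    σ : (a , b) ∷ L ↭ (a , b) ∷ (a , b₁) ∷ (a′ , b′) ∷ (A′ ++ R′) ++ A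
    σ = ↭-prep _ (↭-trans π (↭-prep _ (↭-trans (++-comm A ((a′ , b′) ∷ R)) (↭-prep _ (++⁺ʳ A ρ)))))

  -- Total, with a dummy answer for long lists, because a guess is due on every colouring. Both `u`
  -- and `v` evaluate it on the same list, so their halves `f` and `g` fit together.
  plan : ∀ L → ∃₂ λ f g → length L ℕ.≤ 5 → All (Guesses f g) L
  plan L with length L ℕ.≤? 5
  ... | yes len with f , g , ok ← atMostFive 5 ℕ.≤-refl L len = f , g , const ok
  ... | no  big = id , id , λ len → contradiction len big

-- Supplies the classification that separates six colour pairs. The head takes label zero and the
-- other labels shift; uniqueness prevents the head from overwriting a later element.
labelling : ∀ {A : Set} → DecidableEquality A → ∀ n (L : List A) → Unique L →
            suc n ℕ.≤ length L →
            Σ[ h ∈ (A → Fin (suc n)) ] (∀ k → ∃[ p ] p ∈ L × h p ≡ k)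
labelling _≟_ zero    (p ∷ L) _ _ = const zero , λ { zero → p , here refl , refl }
labelling {A} _≟_ (suc n) (p ∷ L) (p∉L ∷ uniq) (s≤s len)
  with h , onto ← labelling _≟_ n L uniq len = h′ , onto′
  where
  h′ : A → Fin (suc (suc n))
  h′ r with p ≟ r
  ... | yes _ = zero
  ... | no  _ = suc (h r)

  h′-here : h′ p ≡ zero
  h′-here with p ≟ p
  ... | yes _   = refl
  ... | no  p≢p = contradiction refl p≢p

  h′-there : ∀ {r} → r ∈ L → h′ r ≡ suc (h r)
  h′-there {r} r∈L with p ≟ r
  ... | yes p≡r = contradiction p≡r (All.lookup p∉L r∈L)
  ... | no  _   = refl

  onto′ : ∀ k → ∃[ r ] r ∈ p ∷ L × h′ r ≡ k
  onto′ zero    = p , here refl , h′-here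
  onto′ (suc k) with r , r∈L , hr≡k ← onto k =
    r , there r∈L , trans (h′-there r∈L) (cong suc hr≡k)

-- The pairs with t - s congruent to k or k + 6 modulo 12 form the k-th of six
-- classes, each of which two players who see each other can guess completely.
guessˣ guessʸ : Fin 6 → Fin 12 → Fin 12
guessˣ k t = (toℕ t ℕ.+ (12 ℕ.∸ toℕ k)) mod 12
guessʸ k s = (toℕ s ℕ.+ (6 ℕ.+ toℕ k)) mod 12

Caught : Fin 6 → Fin 12 → Fin 12 → Set
Caught k s t = guessˣ k t ≡ s ⊎ guessʸ k s ≡ t

caught? : ∀ k s t → Dec (Caught k s t)
caught? k s t = (guessˣ k t Fin.≟ s) ⊎-dec (guessʸ k s Fin.≟ t)

-- The six tiles cover all 144 colourings of a pair, which is checked by evaluation.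
everyCaught : ∀ s t → ∃[ k ] Caught k s t
everyCaught = from-yes (Fin.all? λ s → Fin.all? λ t → Fin.any? λ k → caught? k s t)

allPairs : ∀ q → List (Colours {q})
allPairs q = cartesianProduct (allFin q) (allFin q)

∈-allPairs : ∀ {q} (p : Colours {q}) → p ∈ allPairs q
∈-allPairs (a , b) = ∈-cartesianProduct⁺ (∈-allFin a) (∈-allFin b)

allPairs-unique : ∀ q → Unique (allPairs q)
allPairs-unique q = Unique.cartesianProduct⁺ (Unique.allFin⁺ q) (Unique.allFin⁺ q)

-- The strategy given by a family of classifications

module _ {m : ℕ} (class : Fin m → Colours {12} → Fin 6) where

  Hit : (s t : Fin m → Fin 12) → Colours → Set
  Hit s t p = ∃[ i ] Caught (class i p) (s i) (t i)

  hit? : ∀ s t p → Dec (Hit s t p)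
  hit? s t p = Fin.any? λ i → caught? (class i p) (s i) (t i)

  missed? : ∀ s t p → Dec (¬ Hit s t p)
  missed? s t p = ¬? (hit? s t p)

  survivors : (s t : Fin m → Fin 12) → List Colours
  survivors s t = filter (missed? s t) (allPairs 12)

  Hit-resp : ∀ {s s′ t t′} → s ≗ s′ → t ≗ t′ → ∀ p → Hit s t p → Hit s′ t′ p
  Hit-resp s≗ t≗ p (i , hit) = i , subst₂ (Caught (class i p)) (s≗ i) (t≗ i) hit

  -- The lists themselves must agree, not just their members, since `plan` is applied to them.
  survivors-cong : ∀ {s s′ t t′} → s ≗ s′ → t ≗ t′ → survivors s t ≡ survivors s′ t′
  survivors-cong {s} {s′} {t} {t′} s≗ t≗ = filter-≐ (missed? s t) (missed? s′ t′)
    ( (λ {p} safe hit → safe (Hit-resp (sym ∘ s≗) (sym ∘ t≗) p hit))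
    , (λ {p} safe hit → safe (Hit-resp s≗ t≗ p hit))) (allPairs 12)

  survivors-few : (∀ h → ∃[ i ] class i ≗ h) → ∀ s t → length (survivors s t) ℕ.≤ 5
  survivors-few complete s t with 6 ℕ.≤? length (survivors s t)
  ... | no  few = ℕ.≤-pred (ℕ.≰⇒> few)
  ... | yes big =
    let unique        = Unique.filter⁺ (missed? s t) (allPairs-unique 12)
        h , onto      = labelling (Product.≡-dec Fin._≟_ Fin._≟_) 5 (survivors s t) unique big
        i , class≗h   = complete h
        -- The tile containing the colours of the `i`-th pair. The survivor `p` labelled `k` is
        -- therefore hit, a contradiction.
        k , caught    = everyCaught (s i) (t i)
        p , p∈ , hp≡k = onto k
    in contradiction
      (i , subst (λ k → Caught k (s i) (t i)) (sym (trans (class≗h p) hp≡k)) caught)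
      (proj₂ (∈-filter⁻ (missed? s t) {xs = allPairs 12} p∈))

  strategy : Strategy (edgeJoinEdges m) 12
  strategy = record { guess = guess ; guess-cong = guess-cong }
    where
    open Graph (edgeJoinEdges m)

    guess : ∀ w → (Neighbour w → Fin 12) → Fin 12
    guess u c =
      proj₁ (plan (survivors (λ i → c (x i , [ fwd (ux i) ])) (λ i → c (y i , [ fwd (uy i) ]))))
        (c (v , [ fwd uv ]))
    guess v c = proj₁ (proj₂
      (plan (survivors (λ i → c (x i , [ fwd (vx i) ])) (λ i → c (y i , [ fwd (vy i) ])))))
        (c (u , [ bwd uv ]))
    guess (x i) c =
      guessˣ (class i (c (u , [ bwd (ux i) ]) , c (v , [ bwd (vx i) ]))) (c (y i , [ fwd (xy i) ]))
    guess (y i) c =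
      guessʸ (class i (c (u , [ bwd (uy i) ]) , c (v , [ bwd (vy i) ]))) (c (x i , [ bwd (xy i) ]))

    guess-cong : ∀ w {c d : Neighbour w → Fin 12} → c ≗ d → guess w c ≡ guess w d
    guess-cong u c≗d =
      cong₂ (λ L → proj₁ (plan L)) (survivors-cong (λ i → c≗d _) (λ i → c≗d _)) (c≗d _)
    guess-cong v c≗d =
      cong₂ (λ L → proj₁ (proj₂ (plan L))) (survivors-cong (λ i → c≗d _) (λ i → c≗d _)) (c≗d _)
    guess-cong (x i) c≗d = cong₂ (guessˣ ∘ class i) (cong₂ _,_ (c≗d _) (c≗d _)) (c≗d _)
    guess-cong (y i) c≗d = cong₂ (guessʸ ∘ class i) (cong₂ _,_ (c≗d _) (c≗d _)) (c≗d _)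

  strategy-winning : (∀ h → ∃[ i ] class i ≗ h) → Winning (edgeJoinEdges m) strategy
  strategy-winning complete c = winner (hit? s t (c u , c v))
    where
    open Strategy strategy

    s t : Fin m → Fin 12
    s = c ∘ x
    t = c ∘ y

    spineWinner : (let f , g , _ = plan (survivors s t)) → Guesses f g (c u , c v) →
                  ∃[ w ] guess w (c ∘ value) ≡ c w
    spineWinner (inj₁ eq) = u , eq
    spineWinner (inj₂ eq) = v , eq

    winner : Dec (Hit s t (c u , c v)) → ∃[ w ] guess w (c ∘ value) ≡ c w
    winner (yes (i , inj₁ eq)) = x i , eq
    winner (yes (i , inj₂ eq)) = y i , eq
    winner (no missed)         = spineWinner (All.lookup
      (proj₂ (proj₂ (plan (survivors s t))) (survivors-few complete s t))
      (∈-filter⁺ (missed? s t) (∈-allPairs (c u , c v)) missed))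

-- The `N` digits of `i` in base `K` give a class to each colour pair once `shrink` reduces digits
-- to six classes. The sections `decode` and `embed` make every classification occur.
lowerBound : ∀ {K N} (encode : Colours {12} → Fin N) (decode : Fin N → Colours {12}) →
             (∀ p → decode (encode p) ≡ p) →
             (shrink : Fin K → Fin 6) (embed : Fin 6 → Fin K) → (∀ k → shrink (embed k) ≡ k) →
             HasWinningStrategy (edgeJoinEdges (K ℕ.^ N)) 12
lowerBound {K} {N} encode decode decode-encode shrink embed shrink-embed =
  strategy class , strategy-winning class complete
  where
  class : Fin (K ℕ.^ N) → Colours {12} → Fin 6
  class i p = shrink (finToFun i (encode p))

  complete : ∀ h → ∃[ i ] class i ≗ h
  complete h = funToFin (embed ∘ h ∘ decode) , λ p → begin
    shrink (finToFun (funToFin (embed ∘ h ∘ decode)) (encode p))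
      ≡⟨ cong shrink (Fin.finToFun-funToFin (embed ∘ h ∘ decode) (encode p)) ⟩
    shrink (embed (h (decode (encode p))))
      ≡⟨ shrink-embed _ ⟩
    h (decode (encode p))
      ≡⟨ cong h (decode-encode p) ⟩
    h p ∎
    where open ≡-Reasoning

winning : HasWinningStrategy (edgeJoinEdges (66 ℕ.^ 144)) 12
winning = lowerBound {66} {144} (uncurry combine) (remQuot {12} 12) (uncurry Fin.remQuot-combine)
  -- Since 66 = 6 + 60, digits below 6 are the classes themselves, and the other 60 are read as
  -- class zero.
  (λ j → Sum.[ id , const zero ] (splitAt 6 j)) (_↑ˡ 60)
  (λ k → cong Sum.[ id , const zero ] (Fin.splitAt-↑ˡ 6 k 60))

-- More than 12 colours

-- Each `α k` and each `β k` is right on the graph of a function, which has `q` points. So `n + n`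
-- such graphs cover all `q * q` pairs.
squareWithin : ∀ {n q} (α β : Fin n → Fin q → Fin q) →
               (∀ s t → ∃[ k ] (α k t ≡ s ⊎ β k s ≡ t)) → q ℕ.≤ n ℕ.+ n
squareWithin {_} {zero} _ _ _ = z≤n
squareWithin {n} {q@(suc _)} α β cover =
  ℕ.*-cancelʳ-≤ q (n ℕ.+ n) q (Fin.injective⇒≤ {f = f} f-injective)
  where
  decode : Fin n ⊎ Fin n → Fin q → Fin q × Fin q
  decode (inj₁ k) t = α k t , t
  decode (inj₂ k) s = s , β k s

  code : ∀ p → ∃₂ λ j r → decode j r ≡ p
  code (s , t) with cover s t
  ... | k , inj₁ refl = inj₁ k , t , refl
  ... | k , inj₂ refl = inj₂ k , s , refl

  split-decode : Fin (n ℕ.+ n) × Fin q → Fin q × Fin q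
  split-decode (l , r) = decode (splitAt n l) r

  -- A pair is sent to a graph through it and its place there, from which `decode` recovers it.
  f : Fin (q ℕ.* q) → Fin ((n ℕ.+ n) ℕ.* q)
  f p = let j , r , _ = code (remQuot {q} q p) in combine (Fin.join n n j) r

  f⁻¹ : Fin ((n ℕ.+ n) ℕ.* q) → Fin (q ℕ.* q)
  f⁻¹ l = uncurry combine (split-decode (remQuot {n ℕ.+ n} q l))

  f⁻¹-f : ∀ p → f⁻¹ (f p) ≡ p
  f⁻¹-f p = let j , r , eq = code (remQuot {q} q p) in begin
    f⁻¹ (combine (Fin.join n n j) r)
      ≡⟨ cong (uncurry combine ∘ split-decode) (Fin.remQuot-combine (Fin.join n n j) r) ⟩
    uncurry combine (decode (splitAt n (Fin.join n n j)) r)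
      ≡⟨ cong (λ j → uncurry combine (decode j r)) (Fin.splitAt-join n n j) ⟩
    uncurry combine (decode j r)
      ≡⟨ cong (uncurry combine) eq ⟩
    uncurry combine (remQuot {q} q p)
      ≡⟨ Fin.combine-remQuot {q} q p ⟩
    p ∎
    where open ≡-Reasoning

  f-injective : ∀ {p p′} → f p ≡ f p′ → p ≡ p′
  f-injective {p} {p′} eq = trans (sym (f⁻¹-f p)) (trans (cong f⁻¹ eq) (f⁻¹-f p′))

-- Counting only refutes full coverage; a finite search turns this into explicit colours.
uncovered : ∀ {n q} → n ℕ.+ n ℕ.< q → (α β : Fin n → Fin q → Fin q) →
            ∃₂ λ s t → ∀ k → α k t ≢ s × β k s ≢ t
uncovered {n} {q} n+n<q α β = search (Fin.any? λ s → Fin.any? λ t → ¬? (covered? s t))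
  where
  covered? : ∀ s t → Dec (∃[ k ] (α k t ≡ s ⊎ β k s ≡ t))
  covered? s t = Fin.any? λ k → (α k t Fin.≟ s) ⊎-dec (β k s Fin.≟ t)

  search : Dec (∃[ s ] ∃[ t ] ¬ (∃[ k ] (α k t ≡ s ⊎ β k s ≡ t))) →
           ∃₂ λ s t → ∀ k → α k t ≢ s × β k s ≢ t
  search (yes (s , t , free)) =
    s , t , λ k → (λ eq → free (k , inj₁ eq)) , (λ eq → free (k , inj₂ eq))
  search (no full) = contradiction
    (squareWithin α β λ s t → decidable-stable (covered? s t) λ free → full (s , t , free))
    (ℕ.<⇒≱ n+n<q)

guess-local : ∀ (G : Graph) {q} (S : Strategy G q) w (c d : Graph.V G → Fin q) →
              (∀ {w′} → Graph._~_ G w w′ → c w′ ≡ d w′) →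
              Strategy.guess S w (c ∘ value) ≡ Strategy.guess S w (d ∘ value)
guess-local G S w c d agree = Strategy.guess-cong S w λ
  -- Adjacency is irrelevant here, so the equality is recovered from its decidability.
  (w′ , [ w~w′ ]) → recompute (c w′ Fin.≟ d w′) (agree w~w′)

-- Each of three columns would be guessed by one of two rows.
grid-unguessable : ∀ {q} {row : Fin 2 → Fin q} {col : Fin 3 → Fin q} →
                   row zero ≢ row (suc zero) → Injective _≡_ _≡_ col →
                   (f : Fin 3 → Fin q) (g : Fin 2 → Fin q) →
                   ¬ (∀ a b → f b ≡ row a ⊎ g a ≡ col b)
grid-unguessable {row = row} {col} row≢ col-injective f g guessed =
  let b , b′ , b<b′ , same = Fin.pigeonhole (ℕ.n<1+n 2) (proj₁ ∘ guesser)
  in Fin.<⇒≢ b<b′ (col-injective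
    (trans (sym (proj₂ (guesser b))) (trans (cong g same) (proj₂ (guesser b′)))))
  where
  guesser : ∀ b → ∃[ a ] g a ≡ col b
  guesser b with guessed zero b | guessed (suc zero) b
  ... | inj₂ eq | _       = zero , eq
  ... | inj₁ _  | inj₂ eq = suc zero , eq
  ... | inj₁ eq | inj₁ eq′ = contradiction (trans (sym eq) eq′) row≢

upperBound : ∀ {m q} → HasWinningStrategy (edgeJoinEdges m) q → q ℕ.≤ 12
upperBound {m} {q} (S , wins) = ℕ.≮⇒≥ impossible
  where
  open Graph (edgeJoinEdges m)
  open Strategy S

  colouring : (a b : Fin q) (s t : Fin m → Fin q) → Vertex m → Fin q
  colouring a b s t u     = a
  colouring a b s t v     = b
  colouring a b s t (x i) = s i
  colouring a b s t (y i) = t i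

  impossible : ¬ 12 ℕ.< q
  impossible 12<q = grid-unguessable {row = row} {col}
    (λ eq → case Fin.inject≤-injective _ _ zero (suc zero) eq of λ ())
    (Fin.inject≤-injective _ _ _ _) f g guessed
    where
    row : Fin 2 → Fin q
    row a = inject≤ a (ℕ.≤-trans (ℕ.m≤m+n 2 11) 12<q)

    col : Fin 3 → Fin q
    col b = inject≤ b (ℕ.≤-trans (ℕ.m≤m+n 3 10) 12<q)

    -- `x i` sees only `u`, `v` and `y i`, and `y i` only `u`, `v` and `x i`. A constant colouring
    -- of the pairs thus stands in for `s` and `t`, which are chosen afterwards.
    α β : Fin m → Fin 2 → Fin 3 → Fin q → Fin q
    α i a b t = guess (x i) (colouring (row a) (col b) (const t) (const t) ∘ value)
    β i a b s = guess (y i) (colouring (row a) (col b) (const s) (const s) ∘ value)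

    free : ∀ i → ∃₂ λ s t → ∀ k →
           uncurry (α i) (remQuot 3 k) t ≢ s × uncurry (β i) (remQuot 3 k) s ≢ t
    -- The 2 by 3 grid has six colourings of `u` and `v`, and `6 + 6 = 12 < q`.
    free i = uncovered {6} 12<q (uncurry (α i) ∘ remQuot 3) (uncurry (β i) ∘ remQuot 3)

    s t : Fin m → Fin q
    s i = proj₁ (free i)
    t i = proj₁ (proj₂ (free i))

    wrong : ∀ i a b → α i a b (t i) ≢ s i × β i a b (s i) ≢ t i
    wrong i a b = subst (λ p → uncurry (α i) p (t i) ≢ s i × uncurry (β i) p (s i) ≢ t i)
      (Fin.remQuot-combine a b) (proj₂ (proj₂ (free i)) (combine a b))

    -- `u` does not see its own colour, so `row zero` is a mere filler; likewise `col zero` for `v`.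
    f : Fin 3 → Fin q
    f b = guess u (colouring (row zero) (col b) s t ∘ value)

    g : Fin 2 → Fin q
    g a = guess v (colouring (row a) (col zero) s t ∘ value)

    same : ∀ w c d → (∀ {w′} → w ~ w′ → c w′ ≡ d w′) → guess w (c ∘ value) ≡ guess w (d ∘ value)
    same = guess-local (edgeJoinEdges m) S

    f-guess : ∀ a b → guess u (colouring (row a) (col b) s t ∘ value) ≡ f b
    f-guess a b = same u (colouring (row a) (col b) s t) (colouring (row zero) (col b) s t) λ where
      (fwd uv)     → refl
      (fwd (ux _)) → refl
      (fwd (uy _)) → refl

    g-guess : ∀ a b → guess v (colouring (row a) (col b) s t ∘ value) ≡ g a
    g-guess a b = same v (colouring (row a) (col b) s t) (colouring (row a) (col zero) s t) λ where
      (bwd uv)     → refl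
      (fwd (vx _)) → refl
      (fwd (vy _)) → refl

    α-guess : ∀ i a b → guess (x i) (colouring (row a) (col b) s t ∘ value) ≡ α i a b (t i)
    α-guess i a b =
      same (x i) (colouring (row a) (col b) s t)
           (colouring (row a) (col b) (const (t i)) (const (t i))) λ where
      (bwd (ux _)) → refl
      (bwd (vx _)) → refl
      (fwd (xy _)) → refl

    β-guess : ∀ i a b → guess (y i) (colouring (row a) (col b) s t ∘ value) ≡ β i a b (s i)
    β-guess i a b =
      same (y i) (colouring (row a) (col b) s t)
           (colouring (row a) (col b) (const (s i)) (const (s i))) λ where
      (bwd (uy _)) → refl
      (bwd (vy _)) → refl
      (bwd (xy _)) → refl

    guessed : ∀ a b → f b ≡ row a ⊎ g a ≡ col b
    guessed a b = spineRight (wins c)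
      where
      c : Vertex m → Fin q
      c = colouring (row a) (col b) s t

      spineRight : (∃[ w ] guess w (c ∘ value) ≡ c w) → f b ≡ row a ⊎ g a ≡ col b
      spineRight (u   , eq) = inj₁ (trans (sym (f-guess a b)) eq)
      spineRight (v   , eq) = inj₂ (trans (sym (g-guess a b)) eq)
      spineRight (x i , eq) = contradiction (trans (sym (α-guess i a b)) eq) (proj₁ (wrong i a b))
      spineRight (y i , eq) = contradiction (trans (sym (β-guess i a b)) eq) (proj₂ (wrong i a b))

theorem1 :
  (∃[ G ] Planar G × IsHatGuessingNumber G 12) ×
  (let m = 66 ^ 144
       G = edgeJoinEdges m
   in Planar G × IsHatGuessingNumber G 12)
theorem1 = (edgeJoinEdges (66 ^ 144) , drawn , guessed) , drawn , guessed
  where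
  drawn : Planar (edgeJoinEdges (66 ^ 144))
  drawn = planar (66 ^ 144)

  guessed : IsHatGuessingNumber (edgeJoinEdges (66 ^ 144)) 12
  guessed = winning , λ _ → upperBound
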